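{- Let $\tilde L$ be a minimum-size counterexample. For every $x\in\tilde L\setminus\{0_{\tilde L},1_{\tilde L}\}$, the set $({\parallel}x)=\{y\in\tilde L: y \text{ is incomparable with } x\}$ is not a chain; that is, there exist two elements of $\tilde L$ that are incomparable with each other and each incomparable with $x$.
   Context: For a poset $P$, $x$ upper covers $y$ if $y<x$ with nothing strictly between; join-irreducible: upper covers exactly one element. For $x\in P$, ${\uparrow}x=\{y: x\le y\}$. A chain is a totally ordered subset (the empty set and singletons count as chains). $0_{\tilde L}$, $1_{\tilde L}$ are the least and greatest elements. A counterexample is a finite lattice $L$ with $|L|>1$ in which every join-irreducible $j$ satisfies $|{\uparrow}j|>|L|/2$; a minimum-size counterexample is a counterexample $\tilde L$ such that no counterexample has fewer elements. -}

module Defs where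

open import Level using (Level; _⊔_) renaming (suc to lsuc)
open import Data.Fin.Base using (Fin)
import Data.Fin.Properties as Fin
open import Data.Nat.Base using (ℕ; _*_) renaming (_<_ to _<ℕ_)
open import Data.Product using (_×_; ∃!)
open import Data.Sum.Base using (_⊎_)
open import Data.Vec.Base using (Vec; count; tabulate)
open import Function.Bundles using (Inverse)
open import Function.Properties.Inverse using (Inverse⇒Injection)
open import Relation.Binary.Bundles using (Poset)
open import Relation.Binary.Core using (Rel)
open import Relation.Binary.Definitions using (Decidable)
open import Relation.Binary.Lattice.Bundles using (Lattice)
import Relation.Binary.Lattice.Properties.JoinSemilattice as JoinSemilatticeProperties
import Relation.Binary.Properties.Poset as PosetProperties
open import Relation.Binary.PropositionalEquality.Core using (_≡_)
import Relation.Binary.PropositionalEquality.Properties as ≡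
open import Relation.Nullary.Decidable using (via-injection)
open import Relation.Nullary.Negation.Core using (¬_)
open import Relation.Unary using (Pred)

module PosetNotions {p ℓ₁ ℓ₂ : Level} (P : Poset p ℓ₁ ℓ₂) where
  open Poset P using (Carrier; _≈_; _≤_)
  open PosetProperties P using (_<_)

  infix 4 _UpperCovers_ _∥_

  _UpperCovers_ : Rel Carrier (p ⊔ ℓ₁ ⊔ ℓ₂)
  x UpperCovers y = (y < x) × (∀ z → ¬ ((y < z) × (z < x)))

  JoinIrreducible : Pred Carrier (p ⊔ ℓ₁ ⊔ ℓ₂)
  JoinIrreducible x = ∃! _≈_ (λ y → x UpperCovers y)

  -- The section (x ∥_) is the set of elements incomparable with x.
  _∥_ : Rel Carrier ℓ₂
  x ∥ y = ¬ (x ≤ y ⊎ y ≤ x)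

  IsChain : {ℓ : Level} → Pred Carrier ℓ → Set (p ⊔ ℓ₂ ⊔ ℓ)
  IsChain S = ∀ y z → S y → S z → y ≤ z ⊎ z ≤ y

-- Elements are counted up to the lattice's equality _≈_.
record FiniteLattice (c ℓ₁ ℓ₂ : Level) : Set (lsuc (c ⊔ ℓ₁ ⊔ ℓ₂)) where
  field
    lattice     : Lattice c ℓ₁ ℓ₂
    size        : ℕ
    enumeration : Inverse (Lattice.setoid lattice) (≡.setoid (Fin size))

  open Lattice lattice public
  open PosetNotions poset public

  infix 4 _≟_ _≤?_

  _≟_ : Decidable _≈_
  _≟_ = via-injection (Inverse⇒Injection enumeration) Fin._≟_

  _≤?_ : Decidable _≤_
  _≤?_ = JoinSemilatticeProperties.≈-dec⇒≤-dec joinSemilattice _≟_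

  -- Contains exactly one representative of each _≈_-class.
  elements : Vec Carrier size
  elements = tabulate (Inverse.from enumeration)

  ∣↑_∣ : Carrier → ℕ
  ∣↑ x ∣ = count (x ≤?_) elements

module _ {c ℓ₁ ℓ₂ : Level} (L : FiniteLattice c ℓ₁ ℓ₂) where
  open FiniteLattice L

  -- |↑j| > |L|/2 is an inequality of rationals, so it is written without
  -- the (truncating) division of ℕ.
  IsCounterexample : Set (c ⊔ ℓ₁ ⊔ ℓ₂)
  IsCounterexample =
    (1 <ℕ size) × (∀ j → JoinIrreducible j → size <ℕ 2 * ∣↑ j ∣)

-- Competitors range over the same universe levels as L; this is no
-- restriction, as every finite lattice is isomorphic to one at any levels.
IsMinimumSizeCounterexample :
  {c ℓ₁ ℓ₂ : Level} → FiniteLattice c ℓ₁ ℓ₂ → Set (lsuc (c ⊔ ℓ₁ ⊔ ℓ₂))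
IsMinimumSizeCounterexample {c} {ℓ₁} {ℓ₂} L =
  IsCounterexample L ×
  (∀ (M : FiniteLattice c ℓ₁ ℓ₂) → IsCounterexample M →
    ¬ (FiniteLattice.size M <ℕ FiniteLattice.size L))

{-# OPTIONS --safe #-}

-- Let x be an element such that ∥x is a chain.  By minimality ↑x is not a
-- counterexample, so it has a join-irreducible k with 2|↑k| ≤ |↑x|, covering
-- u, say.  Some join-irreducible p ≤ k of L is not below u; then k = x ∨ p,
-- and p is incomparable with x since otherwise p = k.  Now let d be the
-- largest join-irreducible in the chain ∥x, so 2|↑(x ∨ d)| ≤ |↑x| too.  As
-- every element is the join of the join-irreducibles below it, and those in
-- ∥x are all ≤ d, the map y ↦ y ∧ x is injective on {y : d ≤ y, x ≰ y}, with
-- values in {y : y < x}.  Counting then gives 2|↑d| ≤ |L|.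
module Submission where

open import Defs
open import Level using (Level)
open import Data.Fin.Base using (Fin; zero; suc)
open import Data.Fin.Induction using (po-wellFounded; po-noetherian)
open import Data.Fin.Properties using (suc-injective; injective⇒≤; any?; toℕ<n)
import Data.Nat.Base as ℕ
import Data.Nat.Properties as ℕ
open import Data.Product using (_×_; _,_; proj₁; proj₂; ∃; ∃₂)
open import Data.Sum.Base as Sum using (_⊎_; inj₁; inj₂; [_,_]′)
open import Data.Vec.Base using (Vec; []; _∷_; count; lookup)
open import Data.Vec.Properties using (count≤n; lookup∘tabulate)
open import Function.Base using (_∘_; _on_; flip)
open import Function.Bundles using (Inverse)
open import Induction.WellFounded using (Acc; acc; WellFounded; module Subrelation)
import Relation.Binary.Construct.On as On
open import Relation.Binary.Definitions using (Minimum; Maximum; Decidable; _Respects_)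
open import Relation.Binary.Lattice.Bundles using (Lattice)
import Relation.Binary.Lattice.Properties.JoinSemilattice as JoinSemilatticeProperties
import Relation.Binary.Properties.Poset as PosetProperties
open import Relation.Binary.PropositionalEquality as ≡ using (_≡_; _≢_)
open import Relation.Nullary.Decidable using (yes; no; ¬?; _×-dec_; _⊎-dec_; decidable-stable)
open import Relation.Nullary.Negation.Core using (¬_; contradiction)
open import Relation.Unary using (Pred) renaming (Decidable to Decidable₁)
open import Relation.Unary.Properties using (U?)

private
  variable
    a p q r : Level
    A : Set a
    n : ℕ.ℕ

-- Counting entries of vectors

≢⇒1<n : {i j : Fin n} → i ≢ j → 1 ℕ.< n
≢⇒1<n {n = 1} {zero} {zero} i≢j = contradiction ≡.refl i≢j
≢⇒1<n {n = ℕ.suc (ℕ.suc _)} _ = ℕ.s≤s (ℕ.s≤s ℕ.z≤n)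

module _ {P : Pred A p} {Q : Pred A q} {R : Pred A r}
         (P? : Decidable₁ P) (Q? : Decidable₁ Q) (R? : Decidable₁ R) where

  count-∪-≤ : (∀ y → P y → Q y ⊎ R y) → (xs : Vec A n) →
              count P? xs ℕ.≤ count Q? xs ℕ.+ count R? xs
  count-∪-≤ cover [] = ℕ.z≤n
  count-∪-≤ cover (y ∷ ys) with P? y | Q? y | R? y | count-∪-≤ cover ys
  ... | no _   | yes _  | yes _  | ih = ℕ.m≤n⇒m≤1+n (ℕ.≤-trans ih (ℕ.+-monoʳ-≤ _ (ℕ.n≤1+n _)))
  ... | no _   | yes _  | no _   | ih = ℕ.m≤n⇒m≤1+n ih
  ... | no _   | no _   | yes _  | ih = ℕ.≤-trans ih (ℕ.+-monoʳ-≤ _ (ℕ.n≤1+n _))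
  ... | no _   | no _   | no _   | ih = ih
  ... | yes _  | yes _  | yes _  | ih = ℕ.s≤s (ℕ.≤-trans ih (ℕ.+-monoʳ-≤ _ (ℕ.n≤1+n _)))
  ... | yes _  | yes _  | no _   | ih = ℕ.s≤s ih
  ... | yes _  | no _   | yes _  | ih = ℕ.≤-trans (ℕ.s≤s ih) (ℕ.≤-reflexive (≡.sym (ℕ.+-suc _ _)))
  ... | yes py | no ¬qy | no ¬ry | _  with cover y py
  ...   | inj₁ qy = contradiction qy ¬qy
  ...   | inj₂ ry = contradiction ry ¬ry

  count-disjoint-≤ : (∀ y → Q y → P y) → (∀ y → R y → P y) → (∀ y → Q y → ¬ R y) →
                     (xs : Vec A n) → count Q? xs ℕ.+ count R? xs ℕ.≤ count P? xs
  count-disjoint-≤ Q⊆P R⊆P disjoint [] = ℕ.z≤n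
  count-disjoint-≤ Q⊆P R⊆P disjoint (y ∷ ys)
    with P? y | Q? y | R? y | count-disjoint-≤ Q⊆P R⊆P disjoint ys
  ... | _      | yes qy | yes ry | _  = contradiction ry (disjoint y qy)
  ... | no ¬py | yes qy | no _   | _  = contradiction (Q⊆P y qy) ¬py
  ... | no ¬py | no _   | yes ry | _  = contradiction (R⊆P y ry) ¬py
  ... | no _   | no _   | no _   | ih = ih
  ... | yes _  | no _   | no _   | ih = ℕ.m≤n⇒m≤1+n ih
  ... | yes _  | yes _  | no _   | ih = ℕ.s≤s ih
  ... | yes _  | no _   | yes _  | ih = ℕ.≤-trans (ℕ.≤-reflexive (ℕ.+-suc _ _)) (ℕ.s≤s ih)

module _ {P : Pred A p} (P? : Decidable₁ P) where

  -- With inverse `rank`, this identifies `Fin (count P? xs)` with the indices of the entries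
  -- satisfying `P`. Comparing counts thus becomes finding injections between `Fin` types.
  position : (xs : Vec A n) → Fin (count P? xs) → Fin n
  position (y ∷ ys) i with P? y
  position (y ∷ ys) zero    | yes _ = zero
  position (y ∷ ys) (suc i) | yes _ = suc (position ys i)
  position (y ∷ ys) i       | no _  = suc (position ys i)

  position-satisfies : (xs : Vec A n) (i : Fin (count P? xs)) → P (lookup xs (position xs i))
  position-satisfies (y ∷ ys) i with P? y
  position-satisfies (y ∷ ys) zero    | yes py = py
  position-satisfies (y ∷ ys) (suc i) | yes _  = position-satisfies ys i
  position-satisfies (y ∷ ys) i       | no _   = position-satisfies ys i

  position-injective : (xs : Vec A n) {i j : Fin (count P? xs)} →
                       position xs i ≡ position xs j → i ≡ j
  position-injective (y ∷ ys) {i} {j} eq with P? y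
  position-injective (y ∷ ys) {zero}  {zero}  eq | yes _ = ≡.refl
  position-injective (y ∷ ys) {suc i} {suc j} eq | yes _ =
    ≡.cong suc (position-injective ys (suc-injective eq))
  position-injective (y ∷ ys) eq | no _ = position-injective ys (suc-injective eq)

  rank : (xs : Vec A n) (i : Fin n) → P (lookup xs i) → Fin (count P? xs)
  rank (y ∷ ys) i pi with P? y
  rank (y ∷ ys) zero    pi | yes _  = zero
  rank (y ∷ ys) (suc i) pi | yes _  = suc (rank ys i pi)
  rank (y ∷ ys) zero    pi | no ¬py = contradiction pi ¬py
  rank (y ∷ ys) (suc i) pi | no _   = rank ys i pi

  position-rank : (xs : Vec A n) (i : Fin n) (pi : P (lookup xs i)) →
                  position xs (rank xs i pi) ≡ i
  position-rank (y ∷ ys) i pi with P? y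
  position-rank (y ∷ ys) zero    pi | yes _  = ≡.refl
  position-rank (y ∷ ys) (suc i) pi | yes _  = ≡.cong suc (position-rank ys i pi)
  position-rank (y ∷ ys) zero    pi | no ¬py = contradiction pi ¬py
  position-rank (y ∷ ys) (suc i) pi | no _   = ≡.cong suc (position-rank ys i pi)

-- Finite lattices and their join-irreducibles

module FiniteLatticeProperties {c ℓ₁ ℓ₂ : Level} (L : FiniteLattice c ℓ₁ ℓ₂) where
  open FiniteLattice L
  open PosetProperties poset using (_<_) public
  open Inverse enumeration using (to; from; to-cong; strictlyInverseʳ)

  lookup-to : ∀ y → lookup elements (to y) ≈ y
  lookup-to y = Eq.trans (Eq.reflexive (lookup∘tabulate from (to y))) (strictlyInverseʳ y)

  to-lookup : ∀ i → to (lookup elements i) ≡ i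
  to-lookup i = ≡.trans (≡.cong to (lookup∘tabulate from i)) (Inverse.strictlyInverseˡ enumeration i)

  to-injective : ∀ {y z} → to y ≡ to z → y ≈ z
  to-injective {y} {z} eq =
    Eq.trans (Eq.sym (strictlyInverseʳ y)) (Eq.trans (Eq.reflexive (≡.cong from eq)) (strictlyInverseʳ z))

  -- This embeds `_<_` into the order pulled back to `Fin size` along `from`, where both directions
  -- of well-foundedness are known.
  <-from-to : ∀ {y z} → y < z → from (to y) < from (to z)
  <-from-to {y} {z} (y≤z , y≉z) =
    ≤-respʳ-≈ (Eq.sym (strictlyInverseʳ z)) (≤-respˡ-≈ (Eq.sym (strictlyInverseʳ y)) y≤z) ,
    λ eq → y≉z (Eq.trans (Eq.sym (strictlyInverseʳ y)) (Eq.trans eq (strictlyInverseʳ z)))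

  <-wellFounded : WellFounded _<_
  <-wellFounded = Subrelation.wellFounded <-from-to
    (On.wellFounded to (po-wellFounded (On.isPartialOrder from isPartialOrder)))

  >-wellFounded : WellFounded (flip _<_)
  >-wellFounded = Subrelation.wellFounded <-from-to
    (On.wellFounded to (po-noetherian (On.isPartialOrder from isPartialOrder)))

  ≤∧≰⇒< : ∀ {y z} → y ≤ z → ¬ (z ≤ y) → y < z
  ≤∧≰⇒< y≤z z≰y = y≤z , λ y≈z → z≰y (reflexive (Eq.sym y≈z))

  module _ {P : Pred Carrier p} (P? : Decidable₁ P) (resp : P Respects _≈_) where

    -- `elements` holds only a representative of the class of `y`; `resp` carries `P y` over to it.
    index : ∀ y → P y → Fin (count P? elements)
    index y py = rank P? elements (to y) (resp (Eq.sym (lookup-to y)) py)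

    position-index : ∀ y (py : P y) → position P? elements (index y py) ≡ to y
    position-index y py = position-rank P? elements (to y) _

    index-injective : ∀ {y z} (py : P y) (pz : P z) → index y py ≡ index z pz → y ≈ z
    index-injective py pz eq = to-injective
      (≡.trans (≡.sym (position-index _ py)) (≡.trans (≡.cong (position P? elements) eq) (position-index _ pz)))

    index-cong : ∀ {y z} (py : P y) (pz : P z) → y ≈ z → index y py ≡ index z pz
    index-cong py pz y≈z = position-injective P? elements
      (≡.trans (position-index _ py) (≡.trans (to-cong y≈z) (≡.sym (position-index _ pz))))

    select : Fin (count P? elements) → Carrier
    select i = lookup elements (position P? elements i)

    select-satisfies : ∀ i → P (select i)
    select-satisfies = position-satisfies P? elements

    select-index : ∀ y (py : P y) → select (index y py) ≈ y
    select-index y py =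
      Eq.trans (Eq.reflexive (≡.cong (lookup elements) (position-index y py))) (lookup-to y)

    index-select : ∀ i (pi : P (select i)) → index (select i) pi ≡ i
    index-select i pi = position-injective P? elements (≡.trans (position-index _ pi) (to-lookup _))

    select-injective : ∀ {i j} → select i ≈ select j → i ≡ j
    select-injective {i} {j} eq = position-injective P? elements
      (≡.trans (≡.sym (to-lookup _)) (≡.trans (to-cong eq) (to-lookup _)))

  -- A minimal y ≰ z covers only y ∧ z.
  ≤-by-joinIrreducibles : ∀ {y z} → (∀ j → JoinIrreducible j → j ≤ y → j ≤ z) → y ≤ z
  ≤-by-joinIrreducibles {y} {z} = go (<-wellFounded y)
    where
    go : ∀ {y} → Acc _<_ y → (∀ j → JoinIrreducible j → j ≤ y → j ≤ z) → y ≤ z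
    go {y} (acc rec) below = decidable-stable (y ≤? z) λ y≰z →
      let
        -- The hypothesis on `y` passes to every `w < y`, so induction gives `w ≤ z`. Hence `y ∧ z`
        -- bounds everything strictly below `y`, which makes `y` join-irreducible.
        <⇒≤∧ : ∀ {w} → w < y → w ≤ y ∧ z
        <⇒≤∧ w<y = ∧-greatest (proj₁ w<y)
          (go (rec w<y) λ j ji j≤w → below j ji (trans j≤w (proj₁ w<y)))
        y∧z<y : y ∧ z < y
        y∧z<y = ≤∧≰⇒< (x∧y≤x y z) λ y≤y∧z → y≰z (trans y≤y∧z (x∧y≤y y z))
        covers : y UpperCovers (y ∧ z)
        covers = y∧z<y , λ w (y∧z<w , w<y) → proj₂ y∧z<w (antisym (proj₁ y∧z<w) (<⇒≤∧ w<y))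
        unique : ∀ {w} → y UpperCovers w → y ∧ z ≈ w
        unique {w} (w<y , gap) = Eq.sym (decidable-stable (w ≟ y ∧ z) λ w≉y∧z →
          gap (y ∧ z) ((<⇒≤∧ w<y , w≉y∧z) , y∧z<y))
      in y≰z (below y (y ∧ z , covers , unique) refl)

  -- If `w < k` were not below `u`, then `k` would cover `w`: any `v` strictly between would satisfy
  -- `w ≤ v ≤ u` by induction upwards. But the only element covered by `k` is `u`.
  joinIrreducible⇒below : ∀ {k} → JoinIrreducible k → ∃ λ u → u < k × (∀ w → w < k → w ≤ u)
  joinIrreducible⇒below {k} (u , (u<k , _) , unique) = u , u<k , λ w → go (>-wellFounded w)
    where
    go : ∀ {w} → Acc (flip _<_) w → w < k → w ≤ u
    go {w} (acc rec) w<k = decidable-stable (w ≤? u) λ w≰u →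
      w≰u (reflexive (Eq.sym (unique (w<k , λ v (w<v , v<k) →
        w≰u (trans (proj₁ w<v) (go (rec w<v) v<k))))))

-- Comparing cardinalities by injections

module _ {c ℓ₁ ℓ₂ c′ ℓ₁′ ℓ₂′ : Level}
         (L : FiniteLattice c ℓ₁ ℓ₂) (M : FiniteLattice c′ ℓ₁′ ℓ₂′) where
  private
    module L = FiniteLattice L
    module M = FiniteLattice M
    module Lₚ = FiniteLatticeProperties L
    module Mₚ = FiniteLatticeProperties M

  -- Conjugating `f` with `select` and `index` gives an injection between `Fin` types. Two lattices
  -- are allowed so that subsets of `L` can be compared with subsets of a principal filter.
  count-injective-≤ :
    {P : Pred L.Carrier p} (P? : Decidable₁ P) → P Respects L._≈_ →
    {Q : Pred M.Carrier q} (Q? : Decidable₁ Q) → Q Respects M._≈_ →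
    (f : L.Carrier → M.Carrier) → (∀ y → P y → Q (f y)) →
    (∀ {y z} → P y → P z → f y M.≈ f z → y L.≈ z) →
    count P? L.elements ℕ.≤ count Q? M.elements
  count-injective-≤ P? P-resp Q? Q-resp f f-maps f-inj =
    injective⇒≤ {f = λ i → Mₚ.index Q? Q-resp (f (select i)) (f-maps _ (sat i))}
      λ {i} {j} eq → Lₚ.select-injective P? P-resp {i} {j}
        (f-inj (sat i) (sat j) (Mₚ.index-injective Q? Q-resp (f-maps _ (sat i)) (f-maps _ (sat j)) eq))
    where
    select = Lₚ.select P? P-resp
    sat = Lₚ.select-satisfies P? P-resp

-- The principal filter as a lattice

-- ↑x is represented on all of L, with y standing for x ∨ y, because its
-- carrier must live at the universe level of the carrier of L.
module PrincipalFilter {c ℓ₁ ℓ₂ : Level} (L : FiniteLattice c ℓ₁ ℓ₂) (x : FiniteLattice.Carrier L) where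
  open FiniteLattice L
  open FiniteLatticeProperties L
  open JoinSemilatticeProperties joinSemilattice using (∨-monotonic)

  x≤-resp : (x ≤_) Respects _≈_
  x≤-resp = ≤-respʳ-≈

  x≤x∨ : ∀ y → x ≤ x ∨ y
  x≤x∨ = x≤x∨y x

  x≤y⇒x∨y≈y : ∀ {y} → x ≤ y → x ∨ y ≈ y
  x≤y⇒x∨y≈y = JoinSemilatticeProperties.x≤y⇒x∨y≈y joinSemilattice

  filterLattice : Lattice c ℓ₁ ℓ₂
  filterLattice = record
    { Carrier = Carrier
    ; _≈_ = _≈_ on (x ∨_)
    ; _≤_ = _≤_ on (x ∨_)
    ; _∨_ = _∨_
    -- Without distributivity, `x ∨ (y ∧ z)` may lie strictly below the meet of `x ∨ y` and `x ∨ z`,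
    -- so the represented elements themselves are met.
    ; _∧_ = λ y z → (x ∨ y) ∧ (x ∨ z)
    ; isLattice = record
      { isPartialOrder = On.isPartialOrder (x ∨_) isPartialOrder
      ; supremum = λ y z →
          ∨-monotonic refl (x≤x∨y y z) ,
          ∨-monotonic refl (y≤x∨y y z) ,
          λ w y≤w z≤w → ∨-least (x≤x∨ w)
            (∨-least (trans (y≤x∨y x y) y≤w) (trans (y≤x∨y x z) z≤w))
      ; infimum = λ y z →
          ∨-least (x≤x∨ y) (x∧y≤x _ _) ,
          ∨-least (x≤x∨ z) (x∧y≤y _ _) ,
          λ w w≤y w≤z → trans (∧-greatest w≤y w≤z) (y≤x∨y x _)
      }
    }

  principalFilter : FiniteLattice c ℓ₁ ℓ₂
  principalFilter = record
    { lattice = filterLattice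
    ; size = ∣↑ x ∣
    ; enumeration = record
      { to = idx
      ; from = sel
      ; to-cong = λ {y} {z} → idx-cong {y} {z}
      ; from-cong = λ { ≡.refl → Eq.refl }
      ; inverse =
          (λ {i} {y} y≈ → ≡.trans
            (index-cong (x ≤?_) x≤-resp (x≤x∨ y) (sat i)
              (Eq.trans y≈ (x≤y⇒x∨y≈y (sat i))))
            (index-select (x ≤?_) x≤-resp i (sat i))) ,
          λ { {y} ≡.refl → Eq.trans (x≤y⇒x∨y≈y (sat _))
                (select-index (x ≤?_) x≤-resp (x ∨ y) (x≤x∨ y)) }
      }
    }
    where
    idx : Carrier → Fin ∣↑ x ∣
    idx y = index (x ≤?_) x≤-resp (x ∨ y) (x≤x∨ y)
    sel : Fin ∣↑ x ∣ → Carrier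
    sel = select (x ≤?_) x≤-resp
    sat : ∀ i → x ≤ sel i
    sat = select-satisfies (x ≤?_) x≤-resp
    idx-cong : ∀ {y z} → x ∨ y ≈ x ∨ z → idx y ≡ idx z
    idx-cong {y} {z} = index-cong (x ≤?_) x≤-resp (x≤x∨ y) (x≤x∨ z)

  -- Elements above `x` represent themselves, so the identity is injective from the up-set of
  -- `x ∨ k` in `L` to that of `k` in the filter. This brings smallness in the filter back to `L`.
  ∣↑x∨k∣≤∣↑k∣ : ∀ k → ∣↑ x ∨ k ∣ ℕ.≤ FiniteLattice.∣↑_∣ principalFilter k
  ∣↑x∨k∣≤∣↑k∣ k = count-injective-≤ L principalFilter
    (x ∨ k ≤?_) ≤-respʳ-≈ (F._≤?_ k) (λ {y} {z} → F.≤-respʳ-≈ {k} {y} {z})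
    (λ y → y) (λ y le → trans le (y≤x∨y x y))
    λ ky kz eq → Eq.trans (Eq.sym (x≤y⇒x∨y≈y (trans (x≤x∨ k) ky)))
                   (Eq.trans eq (x≤y⇒x∨y≈y (trans (x≤x∨ k) kz)))
    where
    module F = FiniteLattice principalFilter

-- Up-sets in a minimum-size counterexample

module _ {c ℓ₁ ℓ₂ : Level} (L : FiniteLattice c ℓ₁ ℓ₂) where
  open FiniteLattice L
  open FiniteLatticeProperties L

  module _ (min : IsMinimumSizeCounterexample L) (x : Carrier) where
    open PrincipalFilter L x using (principalFilter; x≤y⇒x∨y≈y; ∣↑x∨k∣≤∣↑k∣)
    private module F = FiniteLattice principalFilter

    ∣↑j∣-large : ∀ {j} → JoinIrreducible j → ¬ (2 ℕ.* ∣↑ j ∣ ℕ.≤ size)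
    ∣↑j∣-large ji = ℕ.<⇒≱ (proj₂ (proj₁ min) _ ji)

    ∣↑-∣-antitone : ∀ {y z} → y ≤ z → ∣↑ z ∣ ℕ.≤ ∣↑ y ∣
    ∣↑-∣-antitone {y} {z} y≤z = count-injective-≤ L L (z ≤?_) ≤-respʳ-≈ (y ≤?_) ≤-respʳ-≈
      (λ w → w) (λ w z≤w → trans y≤z z≤w) (λ _ _ w≈v → w≈v)

    module _ (chain : IsChain (x ∥_)) where

      -- Counting at a largest join-irreducible incomparable with `x`

      module _ {d : Carrier} (d-ji : JoinIrreducible d) (x∥d : x ∥ d)
               (d-max : ∀ p → JoinIrreducible p → x ∥ p → p ≤ d) where

        -- D is ↑d ∩ ∥x, as d ∥ x excludes y ≤ x; B is {y : y < x}.
        private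
          D? : Decidable₁ (λ y → (d ≤ y) × ¬ (x ≤ y))
          D? y = (d ≤? y) ×-dec ¬? (x ≤? y)

          B? : Decidable₁ (λ y → (y ≤ x) × ¬ (x ≤ y))
          B? y = (y ≤? x) ×-dec ¬? (x ≤? y)

          comparable? : Decidable₁ (λ y → y ≤ x ⊎ x ≤ y)
          comparable? y = (y ≤? x) ⊎-dec (x ≤? y)

          ∣D∣ = count D? elements
          ∣B∣ = count B? elements

        -- A join-irreducible `p ≤ y` is either below `x`, hence below `y ∧ x ≤ z`, or incomparable
        -- with `x`, hence `p ≤ d ≤ z`. Used in both directions, this makes `_∧ x` injective on D.
        meet-reflects-≤ : ∀ {y z} → ¬ (x ≤ y) → d ≤ z → y ∧ x ≤ z → y ≤ z
        meet-reflects-≤ {y} {z} x≰y d≤z y∧x≤z = ≤-by-joinIrreducibles below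
          where
          below : ∀ p → JoinIrreducible p → p ≤ y → p ≤ z
          below p p-ji p≤y with p ≤? x
          ... | yes p≤x = trans (∧-greatest p≤y p≤x) y∧x≤z
          ... | no p≰x  = trans (d-max p p-ji [ (λ x≤p → x≰y (trans x≤p p≤y)) , p≰x ]′) d≤z

        ∣D∣≤∣B∣ : ∣D∣ ℕ.≤ ∣B∣
        ∣D∣≤∣B∣ = count-injective-≤ L L D?
          (λ y≈z (d≤y , x≰y) → ≤-respʳ-≈ y≈z d≤y , x≰y ∘ ≤-respʳ-≈ (Eq.sym y≈z)) B?
          (λ y≈z (y≤x , x≰y) → ≤-respˡ-≈ y≈z y≤x , x≰y ∘ ≤-respʳ-≈ (Eq.sym y≈z))
          (_∧ x) (λ y (_ , x≰y) → x∧y≤y y x , λ x≤y∧x → x≰y (trans x≤y∧x (x∧y≤x y x)))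
          λ {y} {z} (d≤y , x≰y) (d≤z , x≰z) eq → antisym
            (meet-reflects-≤ x≰y d≤z (trans (reflexive eq) (x∧y≤x z x)))
            (meet-reflects-≤ x≰z d≤y (trans (reflexive (Eq.sym eq)) (x∧y≤x y x)))

        ∣↑d∣≤∣D∣+∣↑x∨d∣ : ∣↑ d ∣ ℕ.≤ ∣D∣ ℕ.+ ∣↑ x ∨ d ∣
        ∣↑d∣≤∣D∣+∣↑x∨d∣ = count-∪-≤ (d ≤?_) D? (x ∨ d ≤?_) split elements
          where
          split : ∀ y → d ≤ y → ((d ≤ y) × ¬ (x ≤ y)) ⊎ (x ∨ d ≤ y)
          split y d≤y with x ≤? y
          ... | yes x≤y = inj₂ (∨-least x≤y d≤y)
          ... | no x≰y  = inj₁ (d≤y , x≰y)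

        -- The three sets are pairwise disjoint: B avoids the up-set of `x` by definition, and an
        -- element of D comparable with `x` would have to be below `x`, putting `d` below `x`.
        ∣D∣+∣B∣+∣↑x∣≤size : ∣D∣ ℕ.+ (∣B∣ ℕ.+ ∣↑ x ∣) ℕ.≤ size
        ∣D∣+∣B∣+∣↑x∣≤size = begin
          ∣D∣ ℕ.+ (∣B∣ ℕ.+ ∣↑ x ∣)
            ≤⟨ ℕ.+-monoʳ-≤ ∣D∣ (count-disjoint-≤ comparable? B? (x ≤?_)
                 (λ _ → inj₁ ∘ proj₁) (λ _ → inj₂) (λ _ → proj₂) elements) ⟩
          ∣D∣ ℕ.+ count comparable? elements
            ≤⟨ count-disjoint-≤ U? D? comparable? _ _
                 (λ _ (d≤y , x≰y) → [ (λ y≤x → x∥d (inj₂ (trans d≤y y≤x))) , x≰y ]′) elements ⟩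
          count U? elements
            ≤⟨ count≤n U? elements ⟩
          size ∎
          where open ℕ.≤-Reasoning

        ∣↑x∨d∣-large : ¬ (2 ℕ.* ∣↑ x ∨ d ∣ ℕ.≤ ∣↑ x ∣)
        ∣↑x∨d∣-large small = ∣↑j∣-large d-ji (begin
          2 ℕ.* ∣↑ d ∣                       ≤⟨ ℕ.*-monoʳ-≤ 2 ∣↑d∣≤∣D∣+∣↑x∨d∣ ⟩
          2 ℕ.* (∣D∣ ℕ.+ ∣↑ x ∨ d ∣)         ≡⟨ ℕ.*-distribˡ-+ 2 ∣D∣ _ ⟩
          2 ℕ.* ∣D∣ ℕ.+ 2 ℕ.* ∣↑ x ∨ d ∣     ≤⟨ ℕ.+-monoʳ-≤ (2 ℕ.* ∣D∣) small ⟩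
          -- `2 * ∣D∣` computes to `∣D∣ + (∣D∣ + 0)`; one of the two copies of D is then exchanged
          -- for B.
          2 ℕ.* ∣D∣ ℕ.+ ∣↑ x ∣               ≡⟨ ≡.cong (λ m → (∣D∣ ℕ.+ m) ℕ.+ ∣↑ x ∣) (ℕ.+-identityʳ ∣D∣) ⟩
          (∣D∣ ℕ.+ ∣D∣) ℕ.+ ∣↑ x ∣           ≤⟨ ℕ.+-monoˡ-≤ ∣↑ x ∣ (ℕ.+-monoʳ-≤ ∣D∣ ∣D∣≤∣B∣) ⟩
          (∣D∣ ℕ.+ ∣B∣) ℕ.+ ∣↑ x ∣           ≡⟨ ℕ.+-assoc ∣D∣ ∣B∣ _ ⟩
          ∣D∣ ℕ.+ (∣B∣ ℕ.+ ∣↑ x ∣)           ≤⟨ ∣D∣+∣B∣+∣↑x∣≤size ⟩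
          size                               ∎)
          where open ℕ.≤-Reasoning

      -- Smallness at `p` passes to every larger join-irreducible `r` incomparable with `x`, since
      -- `x ∨ p ≤ x ∨ r`. Induction from above excludes such `r`, so by the chain condition `p` is
      -- largest and can serve as `d`.
      ∣↑x∨p∣-large : ∀ {p} → JoinIrreducible p → x ∥ p → ¬ (2 ℕ.* ∣↑ x ∨ p ∣ ℕ.≤ ∣↑ x ∣)
      ∣↑x∨p∣-large {p} = go (>-wellFounded p)
        where
        go : ∀ {p} → Acc (flip _<_) p → JoinIrreducible p → x ∥ p → ¬ (2 ℕ.* ∣↑ x ∨ p ∣ ℕ.≤ ∣↑ x ∣)
        go {p} (acc rec) p-ji x∥p small = ∣↑x∨d∣-large p-ji x∥p p-max small
          where
          p-max : ∀ r → JoinIrreducible r → x ∥ r → r ≤ p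
          p-max r r-ji x∥r = decidable-stable (r ≤? p) λ r≰p →
            [ (λ p≤r → go (rec (≤∧≰⇒< p≤r r≰p)) r-ji x∥r
                (ℕ.≤-trans (ℕ.*-monoʳ-≤ 2 (∣↑-∣-antitone
                  (∨-least (x≤x∨y x r) (trans p≤r (y≤x∨y x r))))) small))
            , r≰p ]′ (chain p r x∥p x∥r)

      -- In the order of the filter, `u < k` means that `x ∨ u` is strictly below `x ∨ k`. Smallness
      -- at `k` forces every join-irreducible of `L` below `x ∨ k` to be below `x ∨ u`, so the two
      -- joins would coincide.
      filter-∣↑k∣-large : ∀ k → F.JoinIrreducible k → ¬ (2 ℕ.* F.∣↑ k ∣ ℕ.≤ ∣↑ x ∣)
      filter-∣↑k∣-large k k-ji small
        with FiniteLatticeProperties.joinIrreducible⇒below principalFilter k-ji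
      ... | u , (u≤k , u≉k) , below = u≉k (antisym u≤k
              (≤-by-joinIrreducibles λ p p-ji p≤x∨k → decidable-stable (p ≤? x ∨ u) (p≤x∨u p-ji p≤x∨k)))
        where
        small′ : ∀ {y} → x ∨ k ≤ y → 2 ℕ.* ∣↑ y ∣ ℕ.≤ ∣↑ x ∣
        small′ x∨k≤y =
          ℕ.≤-trans (ℕ.*-monoʳ-≤ 2 (ℕ.≤-trans (∣↑-∣-antitone x∨k≤y) (∣↑x∨k∣≤∣↑k∣ k))) small

        p≤x∨u : ∀ {p} → JoinIrreducible p → p ≤ x ∨ k → ¬ ¬ (p ≤ x ∨ u)
        p≤x∨u {p} p-ji p≤x∨k p≰x∨u = ∣↑x∨p∣-large p-ji x∥p (small′ (reflexive (Eq.sym x∨p≈x∨k)))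
          where
          x∨p≈x∨k : x ∨ p ≈ x ∨ k
          -- Otherwise `p` is strictly below `k` in the filter, and `below` puts `x ∨ p`, hence `p`,
          -- under `x ∨ u`.
          x∨p≈x∨k = decidable-stable (x ∨ p ≟ x ∨ k) λ x∨p≉x∨k →
            p≰x∨u (trans (y≤x∨y x p) (below p (∨-least (x≤x∨y x k) p≤x∨k , x∨p≉x∨k)))
          x∥p : x ∥ p
          -- Here `p` equals `x ∨ k`, so its up-set has at most half the size of that of `x`, too
          -- few for a join-irreducible of `L`.
          x∥p (inj₁ x≤p) = ∣↑j∣-large p-ji (ℕ.≤-trans
            (small′ (reflexive (Eq.trans (Eq.sym x∨p≈x∨k) (x≤y⇒x∨y≈y x≤p))))
            (count≤n (x ≤?_) elements))
          x∥p (inj₂ p≤x) = p≰x∨u (trans p≤x (x≤x∨y x u))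

    -- The principal filter would be a smaller counterexample: it contains the distinct elements `x`
    -- and `1L`, and it omits `0L`.
    ∥-notChain : (0L 1L : Carrier) → Minimum _≤_ 0L → Maximum _≤_ 1L →
                 ¬ (x ≈ 0L) → ¬ (x ≈ 1L) → ¬ IsChain (x ∥_)
    ∥-notChain 0L 1L 0-min 1-max x≉0 x≉1 chain = proj₂ min principalFilter
      (1<∣↑x∣ , λ k k-ji → ℕ.≰⇒> (filter-∣↑k∣-large chain k k-ji)) ∣↑x∣<size
      where
      1<∣↑x∣ : 1 ℕ.< ∣↑ x ∣
      1<∣↑x∣ = ≢⇒1<n λ eq →
        x≉1 (index-injective (x ≤?_) ≤-respʳ-≈ refl (1-max x) eq)

      ≰? : Decidable₁ (λ y → ¬ (x ≤ y))
      ≰? y = ¬? (x ≤? y)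

      0<∣≰∣ : 0 ℕ.< count ≰? elements
      0<∣≰∣ = ℕ.≤-<-trans ℕ.z≤n (toℕ<n (index ≰? (λ y≈z → _∘ ≤-respʳ-≈ (Eq.sym y≈z)) 0L
        λ x≤0 → x≉0 (antisym x≤0 (0-min x))))

      ∣↑x∣<size : ∣↑ x ∣ ℕ.< size
      ∣↑x∣<size = begin-strict
        ∣↑ x ∣                            <⟨ ℕ.m<m+n ∣↑ x ∣ 0<∣≰∣ ⟩
        ∣↑ x ∣ ℕ.+ count ≰? elements      ≤⟨ count-disjoint-≤ U? (x ≤?_) ≰? _ _
                                               (λ _ x≤y x≰y → x≰y x≤y) elements ⟩
        count U? elements                 ≤⟨ count≤n U? elements ⟩
        size                              ∎
        where open ℕ.≤-Reasoning

  -- Extracting two incomparable elements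

  ∥-resp-≈ : ∀ {y y′ z z′} → y ≈ y′ → z ≈ z′ → y ∥ z → y′ ∥ z′
  ∥-resp-≈ y≈y′ z≈z′ y∥z = y∥z ∘ Sum.map
    (≤-respˡ-≈ (Eq.sym y≈y′) ∘ ≤-respʳ-≈ (Eq.sym z≈z′))
    (≤-respˡ-≈ (Eq.sym z≈z′) ∘ ≤-respʳ-≈ (Eq.sym y≈y′))

  ∥-dec : Decidable _∥_
  ∥-dec y z = ¬? ((y ≤? z) ⊎-dec (z ≤? y))

  -- A negated universal statement yields no witnesses constructively, so they are found by
  -- exhaustive search over pairs of representatives. A failed search would make the section a
  -- chain.
  notChain⇒∥ : ∀ {x} → ¬ IsChain (x ∥_) → ∃₂ λ y z → (y ∥ z) × (x ∥ y) × (x ∥ z)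
  notChain⇒∥ {x} notChain
    with any? (λ i → any? (λ j →
           ∥-dec (lookup elements i) (lookup elements j) ×-dec
           ∥-dec x (lookup elements i) ×-dec ∥-dec x (lookup elements j)))
  ... | yes (_ , _ , witnesses) = _ , _ , witnesses
  ... | no none = contradiction chain notChain
    where
    open Inverse enumeration using (to)
    chain : IsChain (x ∥_)
    chain y z x∥y x∥z = decidable-stable ((y ≤? z) ⊎-dec (z ≤? y)) λ y∥z →
      none (to y , to z ,
        ∥-resp-≈ (Eq.sym (lookup-to y)) (Eq.sym (lookup-to z)) y∥z ,
        ∥-resp-≈ Eq.refl (Eq.sym (lookup-to y)) x∥y ,
        ∥-resp-≈ Eq.refl (Eq.sym (lookup-to z)) x∥z)

theorem2p13 : {c ℓ₁ ℓ₂ : Level} (L : FiniteLattice c ℓ₁ ℓ₂) →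
    IsMinimumSizeCounterexample L →
    let open FiniteLattice L in
    (0L 1L : Carrier) → Minimum _≤_ 0L → Maximum _≤_ 1L →
    (x : Carrier) → ¬ (x ≈ 0L) → ¬ (x ≈ 1L) →
    (¬ IsChain (x ∥_)) ×
    (∃₂ λ y z → (y ∥ z) × (x ∥ y) × (x ∥ z))
theorem2p13 L min 0L 1L 0-min 1-max x x≉0 x≉1 = notChain , notChain⇒∥ L notChain
  where
  open FiniteLattice L using (_∥_; IsChain)
  notChain : ¬ IsChain (x ∥_)
  notChain = ∥-notChain L min x 0L 1L 0-min 1-max x≉0 x≉1
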